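{- For every integer $k \ge 0$, $|I_k(231)|$ is equal to the number of fountains of coins with exactly $k$ coins.
   Context: A permutation of length $n$ is a word $\pi=\pi_1\cdots\pi_n$ containing each of $1,\dots,n$ exactly once. The sum of permutations $\rho=\rho_1\cdots\rho_n$ and $\tau=\tau_1\cdots\tau_m$ is the permutation $\rho\oplus\tau=\rho_1\cdots\rho_n(n+\tau_1)\cdots(n+\tau_m)$ of length $n+m$. A permutation is decomposable if it equals $\rho\oplus\tau$ for some non-empty permutations $\rho,\tau$; a non-empty permutation that is not decomposable is indecomposable. An inversion of $\pi$ is a pair $(i,j)$ with $i<j$ and $\pi_i>\pi_j$. A permutation $\pi$ contains a permutation (pattern) $\tau=\tau_1\cdots\tau_m$ if there are indices $i_1<\dots<i_m$ such that $\pi_{i_1},\dots,\pi_{i_m}$ is order-isomorphic to $\tau_1,\dots,\tau_m$; otherwise $\pi$ avoids $\tau$. $I_k(\tau_1,\dots,\tau_r)$ denotes the (finite) set of all indecomposable permutations, of any length, with exactly $k$ inversions that avoid all of $\tau_1,\dots,\tau_r$. A fountain of coins is an arrangement of coins in rows such that the bottom row is full (contiguous, without holes) and each coin in a higher row rests on two adjacent coins in the row below. Formally, a fountain with $N\ge 0$ coins in the bottom row is a set $F$ of pairs $(h,p)$ of integers (row $h\ge 0$, position $p$ with $1\le p\le N-h$) such that $(0,p)\in F$ for all $1\le p\le N$, and whenever $(h,p)\in F$ with $h\ge 1$ then $(h-1,p)\in F$ and $(h-1,p+1)\in F$. Its coins are the elements of $F$. The empty fountain ($N=0$) is allowed. 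-}

module Defs where

open import Data.Fin.Base as Fin using (Fin)
import Data.Fin.Properties as Fin
open import Data.List.Base
  using (List; []; _++_; map; length; lookup; filter; allFin; applyUpTo; upTo; cartesianProduct)
open import Data.List.Relation.Binary.Permutation.Propositional using (_↭_)
open import Data.List.Relation.Unary.All using (All)
open import Data.Nat.Base using (ℕ; suc; _+_; _∸_; _≤_; _<_; _>_)
open import Data.Nat.Properties using (_<?_)
open import Data.Product.Base using (Σ; ∃; ∃₂; _×_; _,_; proj₁)
open import Function.Base using (_∘_)
open import Function.Bundles using (Inverse; _⇔_)
open import Level using (Level; 0ℓ; _⊔_) renaming (suc to lsuc)
open import Relation.Binary.Bundles using (Setoid)
import Relation.Binary.Construct.On as On
open import Relation.Binary.PropositionalEquality using (_≡_; _≢_; setoid)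
open import Relation.Nullary using (¬_)
open import Relation.Nullary.Decidable using (_×-dec_)
open import Relation.Unary using (Pred; Decidable)
open import Relation.Unary.Relation.Binary.Equality using (≐-setoid)

-- Finite cardinality: S is in bijection, up to its equality, with Fin m.
HasCardinality : ∀ {c ℓ : Level} → Setoid c ℓ → ℕ → Set (c ⊔ ℓ)
HasCardinality S m = Inverse S (setoid (Fin m))

Word : Set
Word = List ℕ

-- Each of 1, …, n occurs exactly once, n being the length of the word.
IsPermutation : Pred Word 0ℓ
IsPermutation w = w ↭ applyUpTo suc (length w)

infixr 6 _⊕_

_⊕_ : Word → Word → Word
ρ ⊕ τ = ρ ++ map (length ρ +_) τ

Decomposable : Pred Word 0ℓ
Decomposable π = ∃₂ λ ρ τ →
  (IsPermutation ρ × ρ ≢ []) × (IsPermutation τ × τ ≢ []) × π ≡ ρ ⊕ τ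

Indecomposable : Pred Word 0ℓ
Indecomposable π = π ≢ [] × ¬ Decomposable π

Inversion : (π : Word) → Pred (Fin (length π) × Fin (length π)) 0ℓ
Inversion π (i , j) = i Fin.< j × lookup π i > lookup π j

inversion? : (π : Word) → Decidable (Inversion π)
inversion? π (i , j) = (i Fin.<? j) ×-dec (lookup π j <? lookup π i)

inversions : Word → ℕ
inversions π =
  length (filter (inversion? π) (cartesianProduct (allFin (length π)) (allFin (length π))))

-- The indices i₁ < ⋯ < iₘ are given as a strictly increasing map ι.
Contains : Word → Word → Set
Contains π τ = ∃ λ (ι : Fin (length τ) → Fin (length π)) →
  (∀ {a b} → a Fin.< b → ι a Fin.< ι b) ×
  (∀ a b → lookup τ a < lookup τ b ⇔ lookup π (ι a) < lookup π (ι b))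

Avoids : Word → Word → Set
Avoids π τ = ¬ Contains π τ

InI : ℕ → List Word → Pred Word 0ℓ
InI k τs π = IsPermutation π × Indecomposable π × inversions π ≡ k × All (Avoids π) τs

-- Members of I are compared as words; the membership proofs are irrelevant.
I : ℕ → List Word → Setoid 0ℓ 0ℓ
I k τs = On.setoid {B = Σ Word (InI k τs)} (setoid Word) proj₁

-- A finite set of coins is a decidable predicate on pairs (row , position).
-- Positions start at 1, so inRange leaves no coin in a row h > N, where the
-- truncated N ∸ h is 0.
record Fountain : Set₁ where
  field
    N        : ℕ
    Coin     : Pred (ℕ × ℕ) 0ℓ
    coin?    : Decidable Coin
    inRange  : ∀ {h p} → Coin (h , p) → 1 ≤ p × p ≤ N ∸ h
    bottom   : ∀ {p} → 1 ≤ p → p ≤ N → Coin (0 , p)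
    supportˡ : ∀ {h p} → Coin (suc h , p) → Coin (h , p)
    supportʳ : ∀ {h p} → Coin (suc h , p) → Coin (h , suc p)

open Fountain public using (Coin)

-- By inRange every coin has h < N and 1 ≤ p ≤ N, so this counts them all.
coins : Fountain → ℕ
coins F = length (filter coin? (cartesianProduct (upTo N) (applyUpTo suc N)))
  where open Fountain F

-- Fountains are compared as sets of coins; equal sets have equal N, by inRange
-- and bottom.
Fountains : ℕ → Setoid (lsuc 0ℓ) 0ℓ
Fountains k = On.setoid {B = Σ Fountain (λ F → coins F ≡ k)} (≐-setoid (ℕ × ℕ) 0ℓ) (Coin ∘ proj₁)

{-# OPTIONS --safe #-}
module Submission where

-- Both families are put in bijection with the sequences a₁, …, aₙ of positive
-- numbers with aᵢ ≤ aᵢ₊₁ + 1, where aₙ₊₁ is read as 0. These are called profiles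
-- below; k is the sum of the profile on both sides.
--
-- Fountains. By the support condition the coins of position p fill the rows
-- 0, …, aₚ - 1 for some aₚ, which is positive because the bottom row is full. The
-- remaining support condition, that of a coin of position p on one of position
-- p + 1, says exactly that aₚ ≤ aₚ₊₁ + 1 (fountain, fountain-profile). The number
-- of coins is the sum of the aₚ, by counting them position by position
-- (coins≡sum).
--
-- Permutations. For a permutation of length n + 1 let aᵥ be the number of letters
-- larger than v to the left of v. The permutation is rebuilt from these numbers by
-- starting from the word 1 and, for v = n, …, 1, raising all letters by one and
-- inserting the letter 1 at index aᵥ (push, permutation). Each insertion adds aᵥ
-- inversions (inversionsʳ-push), and it has two further effects.
-- * Insertion at index a into a word avoiding 231 creates 231 exactly when two of
--   the first a letters form an ascent (push-avoids, ascent⇒Contains231). If the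
--   previous insertion was at index b, then the first b + 1 letters decrease, the
--   last of them being the previously inserted one, and any longer prefix has an
--   ascent (permutation-descending, push-ascent). So 231 is avoided if and only
--   if a ≤ b + 1 at every step.
-- * As long as 231 is avoided, the result is indecomposable if and only if the
--   word before was and a is positive (push-decomposable,
--   permutation-indecomposable). Indeed a = 0 splits off the summand 1, and an
--   insertion beyond the first summand of a decomposable word creates 231.
-- So the profiles are the sequences belonging to indecomposable permutations that
-- avoid 231 (permutation-surjective, permutation-injective).
--
-- There are finitely many profiles of sum k, and their number is the common
-- cardinality.

open import Defs
open import Data.Bool.Base using (Bool; true; false; if_then_else_)
open import Data.Empty using (⊥)
open import Data.Fin.Base as Fin using (Fin; zero; suc)
open import Data.List.Base hiding (sum; _∷ʳ_)
open import Data.List.Properties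
  using (≡-dec; ∷-injective; map-∘; map-++; map-cong; map-injective; map-tabulate;
         map-applyUpTo; map-upTo; tabulate-lookup; filter-≐; filter-++; filter-none;
         filter-reject; filter-accept; length-++; length-map; length-applyUpTo; take-take)
open import Data.List.Membership.Propositional using (_∈_)
open import Data.List.Membership.Propositional.Properties
  using (∈-lookup; ∈-∃++; ∈-applyUpTo⁻; ∈-upTo⁺; ∈-filter⁺; ∈-filter⁻; ∈-deduplicate⁺;
         ∈-cartesianProductWith⁺)
open import Data.List.Relation.Binary.Permutation.Propositional
  using (_↭_; ↭-refl; ↭-sym; ↭-trans; ↭-reflexive; prep; swap)
open import Data.List.Relation.Binary.Permutation.Propositional.Properties
  using (↭-length; ↭-map-inv; ∈-resp-↭; drop-mid; map⁺)
open import Data.List.Relation.Binary.Pointwise.Base using (Pointwise; []; _∷_)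
open import Data.List.Relation.Binary.Sublist.Propositional
  using (_⊆_; []; _∷_; _∷ʳ_; ⊆-trans; ⊆-refl; from∈; minimum)
import Data.List.Relation.Binary.Sublist.Propositional.Properties as Sublist
open import Data.List.Relation.Unary.All as All using (All; []; _∷_)
import Data.List.Relation.Unary.All.Properties as All
open import Data.List.Relation.Unary.AllPairs using (AllPairs; []; _∷_)
import Data.List.Relation.Unary.AllPairs.Properties as AllPairs
open import Data.List.Relation.Unary.Any using (here; there; index)
open import Data.List.Relation.Unary.Any.Properties using (lookup-index)
open import Data.List.Relation.Unary.Unique.Propositional using (Unique)
open import Data.List.Relation.Unary.Unique.Propositional.Properties using (filter⁺)
import Data.List.Relation.Unary.Unique.DecPropositional.Properties as DecUnique
open import Data.Nat.Base
open import Data.Nat.ListAction using (sum)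
open import Data.Nat.Properties
open import Data.Product.Base using (_×_; _,_; proj₁; proj₂; ∃; ∃₂; ∃-syntax)
open import Function.Base using (_∘_; id)
open import Function.Bundles using (_⇔_; mk⇔; module Equivalence)
open import Level using (Level; 0ℓ)
open import Relation.Binary.Bundles using (Setoid)
open import Relation.Binary.PropositionalEquality
  using (_≡_; _≢_; refl; sym; trans; cong; cong₂; subst; module ≡-Reasoning)
open import Relation.Nullary using (¬_; does; yes; no; contradiction)
open import Relation.Nullary.Decidable using (_×-dec_; map′)
open import Relation.Unary using (Pred; Decidable; _≐_)

private variable
  a b c ℓ r p q : Level
  A : Set a
  B : Set b

-- Finite cardinality from a correspondence

lookup-injective : ∀ {xs : List A} → Unique xs → ∀ i j → lookup xs i ≡ lookup xs j → i ≡ j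
lookup-injective (x∉ ∷ u) zero    zero    eq = refl
lookup-injective (x∉ ∷ u) zero    (suc j) eq = contradiction eq (All.lookup x∉ (∈-lookup j))
lookup-injective (x∉ ∷ u) (suc i) zero    eq =
  contradiction (sym eq) (All.lookup x∉ (∈-lookup i))
lookup-injective (x∉ ∷ u) (suc i) (suc j) eq = cong suc (lookup-injective u i j eq)

-- A relation between a repetition-free list and a setoid that is total,
-- surjective, functional and injective exhibits the length of the list as the
-- cardinality of the setoid.
correspondence⇒cardinality :
  (S : Setoid c ℓ) (let open Setoid S) (xs : List A) → Unique xs →
  (R : A → Carrier → Set r) →
  (∀ {x} → x ∈ xs → ∃ (R x)) →
  (∀ s → ∃ λ x → x ∈ xs × R x s) →
  (∀ {x s t} → R x s → R x t → s ≈ t) →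
  (∀ {x y s t} → x ∈ xs → y ∈ xs → R x s → R y t → s ≈ t → x ≡ y) →
  HasCardinality S (length xs)
correspondence⇒cardinality S xs unique R total surj functional injective = record
  { to        = to
  ; from      = from
  ; to-cong   = λ {s} {t} s≈t →
      let x , x∈ , Rxs = surj s ; y , y∈ , Ryt = surj t in
      lookup-injective unique _ _
        (trans (sym (lookup-index x∈))
          (trans (injective x∈ y∈ Rxs Ryt s≈t) (lookup-index y∈)))
  ; from-cong = λ { refl → Setoid.refl S }
  ; inverse   =
      (λ {i} {s} s≈ →
        let x , x∈ , Rxs = surj s in
        lookup-injective unique _ _
          (trans (sym (lookup-index x∈))
            (injective x∈ (∈-lookup i) Rxs (proj₂ (total (∈-lookup i))) s≈)))
    , (λ { {s} refl →
        let x , x∈ , Rxs = surj s in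
        functional (proj₂ (total (∈-lookup (index x∈))))
          (subst (λ y → R y s) (lookup-index x∈) Rxs) })
  }
  where
  open Setoid S using (Carrier)
  to : Carrier → Fin (length xs)
  to s = index (proj₁ (proj₂ (surj s)))
  from : Fin (length xs) → Carrier
  from i = proj₁ (total (∈-lookup i))

-- Counting

-- The number of entries of a list that satisfy P, with multiplicity.
count : {P : Pred A p} → Decidable P → List A → ℕ
count P? xs = length (filter P? xs)

indicator : Bool → ℕ
indicator b = if b then 1 else 0

count-∷ : {P : Pred A p} (P? : Decidable P) (x : A) (xs : List A) →
  count P? (x ∷ xs) ≡ indicator (does (P? x)) + count P? xs
count-∷ P? x xs with does (P? x)
... | true  = refl
... | false = refl

count-++ : {P : Pred A p} (P? : Decidable P) (xs ys : List A) →
  count P? (xs ++ ys) ≡ count P? xs + count P? ys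
count-++ P? xs ys = trans (cong length (filter-++ P? xs ys)) (length-++ (filter P? xs))

count-none : {P : Pred A p} (P? : Decidable P) {xs : List A} →
  All (λ x → ¬ P x) xs → count P? xs ≡ 0
count-none P? none = cong length (filter-none P? none)

count-≐ : {P : Pred A p} {Q : Pred A q} (P? : Decidable P) (Q? : Decidable Q) → P ≐ Q →
  ∀ xs → count P? xs ≡ count Q? xs
count-≐ P? Q? P≐Q xs = cong length (filter-≐ P? Q? P≐Q xs)

count-map : {P : Pred B p} (P? : Decidable P) (f : A → B) (xs : List A) →
  count P? (map f xs) ≡ count (P? ∘ f) xs
count-map P? f []       = refl
count-map P? f (x ∷ xs) with does (P? (f x))
... | true  = cong suc (count-map P? f xs)
... | false = count-map P? f xs

count-rows : {P : Pred (A × B) p} (P? : Decidable P) (xs : List A) (ys : List B) →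
  count P? (cartesianProduct xs ys) ≡ sum (map (λ x → count (λ y → P? (x , y)) ys) xs)
count-rows P? []       ys = refl
count-rows P? (x ∷ xs) ys = trans
  (count-++ P? (map (x ,_) ys) (cartesianProduct xs ys))
  (cong₂ _+_ (count-map P? (x ,_) ys) (count-rows P? xs ys))

-- Exchanging the order of summation in count-rows.
count-columns : {P : Pred (A × B) p} (P? : Decidable P) (xs : List A) (ys : List B) →
  count P? (cartesianProduct xs ys) ≡ sum (map (λ y → count (λ x → P? (x , y)) xs) ys)
count-columns {A = A} {B = B} P? xs ys = trans (count-rows P? xs ys) (exchange xs)
  where
  open ≡-Reasoning
  row : A → List B → ℕ
  row x = count (λ y → P? (x , y))
  column : List A → B → ℕ
  column xs y = count (λ x → P? (x , y)) xs

  zeros : ∀ ys → 0 ≡ sum (map (column []) ys)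
  zeros []       = refl
  zeros (_ ∷ ys) = zeros ys

  addRow : ∀ x xs ys → row x ys + sum (map (column xs) ys) ≡ sum (map (column (x ∷ xs)) ys)
  addRow x xs []       = refl
  addRow x xs (y ∷ ys) = begin
    row x (y ∷ ys) + (column xs y + s)
      ≡⟨ cong (_+ (column xs y + s)) (count-∷ (λ y → P? (x , y)) y ys) ⟩
    i + row x ys + (column xs y + s)
      ≡⟨ +-assoc i (row x ys) _ ⟩
    i + (row x ys + (column xs y + s))
      ≡⟨ cong (i +_) (+-assoc (row x ys) (column xs y) s) ⟨
    i + (row x ys + column xs y + s)
      ≡⟨ cong (λ n → i + (n + s)) (+-comm (row x ys) (column xs y)) ⟩
    i + (column xs y + row x ys + s)
      ≡⟨ cong (i +_) (+-assoc (column xs y) (row x ys) s) ⟩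
    i + (column xs y + (row x ys + s))
      ≡⟨ +-assoc i (column xs y) _ ⟨
    i + column xs y + (row x ys + s)
      ≡⟨ cong₂ _+_ (sym (count-∷ (λ x → P? (x , y)) x xs)) (addRow x xs ys) ⟩
    column (x ∷ xs) y + sum (map (column (x ∷ xs)) ys)
      ∎
    where
    i = indicator (does (P? (x , y)))
    s = sum (map (column xs) ys)

  exchange : ∀ xs → sum (map (λ x → row x ys) xs) ≡ sum (map (column xs) ys)
  exchange []       = zeros ys
  exchange (x ∷ xs) = trans (cong (row x ys +_) (exchange xs)) (addRow x xs ys)

count-upTo-suc : {P : Pred ℕ p} (P? : Decidable P) (n : ℕ) →
  count P? (upTo (suc n)) ≡ indicator (does (P? 0)) + count (P? ∘ suc) (upTo n)
count-upTo-suc P? n = trans (count-∷ P? 0 (applyUpTo suc n)) (cong (indicator (does (P? 0)) +_)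
  (trans (cong (count P?) (sym (map-upTo suc n))) (count-map P? suc (upTo n))))

count-initial : {P : Pred ℕ p} (P? : Decidable P) (n m : ℕ) → m ≤ n →
  (∀ h → P h ⇔ h < m) → count P? (upTo n) ≡ m
count-initial P? n m m≤n P⇔< = trans
  (count-≐ P? (_<? m)
    ((λ {h} → Equivalence.to (P⇔< h)) , (λ {h} → Equivalence.from (P⇔< h))) (upTo n))
  (count-< n m m≤n)
  where
  count-< : ∀ n m → m ≤ n → count (_<? m) (upTo n) ≡ m
  count-< n       zero    _         = count-none (_<? 0) {upTo n} (All.universal (λ _ ()) _)
  count-< (suc n) (suc m) (s≤s m≤n) =
    trans (count-upTo-suc (_<? suc m) n) (cong suc (trans
      (count-≐ ((_<? suc m) ∘ suc) (_<? m) (s≤s⁻¹ , s≤s) (upTo n)) (count-< n m m≤n)))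

-- A downward closed set of naturals below n is an initial segment, and so
-- consists of the numbers below its cardinality.
initial-count : {P : Pred ℕ p} (P? : Decidable P) (n : ℕ) →
  (∀ {h} → P (suc h) → P h) → (∀ {h} → P h → h < n) → ∀ h → P h ⇔ h < count P? (upTo n)
initial-count P? zero    down bound h = mk⇔ bound (λ ())
initial-count {P = P} P? (suc n) down bound h rewrite count-upTo-suc P? n with P? 0
... | no ¬P0 = mk⇔ (λ Ph → contradiction (toZero h Ph) ¬P0)
    (λ h< → contradiction h< (subst (λ m → ¬ (h < m)) (sym none) λ ()))
  where
  toZero : ∀ h → P h → P 0
  toZero zero    P0 = P0
  toZero (suc h) Ph = toZero h (down Ph)
  none : count (P? ∘ suc) (upTo n) ≡ 0
  none = count-none (P? ∘ suc) {upTo n} (All.universal (λ h Ph → ¬P0 (toZero (suc h) Ph)) _)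
... | yes P0 with h
...   | zero   = mk⇔ (λ _ → s≤s z≤n) (λ _ → P0)
...   | suc h′ = mk⇔ (s≤s ∘ Equivalence.to ih) (Equivalence.from ih ∘ s≤s⁻¹)
  where ih = initial-count (P? ∘ suc) n down (s≤s⁻¹ ∘ bound) h′

-- Profiles

-- The entry of a sequence at a position counted from 0, and 0 past its end.
at : List ℕ → ℕ → ℕ
at []       _       = 0
at (x ∷ xs) zero    = x
at (x ∷ xs) (suc i) = at xs i

-- Sequences of positive numbers that drop by at most one at each step, where a
-- final 0 is understood; in particular the last entry is 1.
data Profile : Pred (List ℕ) 0ℓ where
  []   : Profile []
  cons : ∀ {x xs} → 1 ≤ x → x ≤ suc (at xs 0) → Profile xs → Profile (x ∷ xs)

profile? : Decidable Profile
profile? []       = yes []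
profile? (x ∷ xs) = map′ (λ (x≥1 , x≤ , v) → cons x≥1 x≤ v) (λ { (cons x≥1 x≤ v) → x≥1 , x≤ , v })
  ((1 ≤? x) ×-dec (x ≤? suc (at xs 0)) ×-dec profile? xs)

profile⁺ : ∀ xs → (∀ i → i < length xs → 1 ≤ at xs i) → (∀ i → at xs i ≤ suc (at xs (suc i))) →
  Profile xs
profile⁺ []       _   _    = []
profile⁺ (x ∷ xs) pos drop = cons (pos 0 (s≤s z≤n)) (drop 0)
  (profile⁺ xs (λ i i< → pos (suc i) (s≤s i<)) (drop ∘ suc))

at-positive : ∀ {xs} → Profile xs → ∀ i → i < length xs → 1 ≤ at xs i
at-positive (cons x≥1 _ v) zero    _        = x≥1
at-positive (cons _   _ v) (suc i) (s≤s i<) = at-positive v i i<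

at-drop : ∀ {xs} → Profile xs → ∀ i → at xs i ≤ suc (at xs (suc i))
at-drop []            i       = z≤n
at-drop (cons _ x≤ v) zero    = x≤
at-drop (cons _ _  v) (suc i) = at-drop v i

at-bound : ∀ {xs} → Profile xs → ∀ i → at xs i ≤ length xs ∸ i
at-bound []            i       = z≤n
at-bound (cons _ x≤ v) zero    = ≤-trans x≤ (s≤s (at-bound v 0))
at-bound (cons _ x≤ v) (suc i) = at-bound v i

at≡⇒≡ : ∀ {xs ys} → Profile xs → Profile ys → (∀ i → at xs i ≡ at ys i) → xs ≡ ys
at≡⇒≡ []           []           eq = refl
at≡⇒≡ []           (cons y≥1 _ _) eq = contradiction (eq 0) (<⇒≢ y≥1)
at≡⇒≡ (cons x≥1 _ _) []           eq = contradiction (sym (eq 0)) (<⇒≢ x≥1)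
at≡⇒≡ (cons _ _ v) (cons _ _ w) eq = cong₂ _∷_ (eq 0) (at≡⇒≡ v w (eq ∘ suc))

at-applyUpTo : ∀ (f : ℕ → ℕ) {n i} → i < n → at (applyUpTo f n) i ≡ f i
at-applyUpTo f {suc n} {zero}  _         = refl
at-applyUpTo f {suc n} {suc i} (s≤s i<n) = at-applyUpTo (f ∘ suc) i<n

at-nonzero⇒< : ∀ xs i → 0 < at xs i → i < length xs
at-nonzero⇒< (x ∷ xs) zero    _   = s≤s z≤n
at-nonzero⇒< (x ∷ xs) (suc i) pos = s≤s (at-nonzero⇒< xs i pos)

applyUpTo-at : ∀ xs → applyUpTo (at xs) (length xs) ≡ xs
applyUpTo-at []       = refl
applyUpTo-at (x ∷ xs) = cong (x ∷_) (applyUpTo-at xs)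

-- All sequences of length at most n with entries at most b.
sequences : ℕ → ℕ → List (List ℕ)
sequences b zero    = [] ∷ []
sequences b (suc n) = [] ∷ cartesianProductWith _∷_ (upTo (suc b)) (sequences b n)

∈-sequences : ∀ {xs b} n → Profile xs → sum xs ≤ n → sum xs ≤ b → xs ∈ sequences b n
∈-sequences zero    []                      _   _   = here refl
∈-sequences (suc n) []                      _   _   = here refl
∈-sequences zero    (cons (s≤s _) _ v)      ()  _
∈-sequences (suc n) (cons {suc x} {xs} _ _ v) (s≤s ≤n) ≤b = there
  (∈-cartesianProductWith⁺ _∷_ (∈-upTo⁺ (s≤s (m+n≤o⇒m≤o (suc x) ≤b)))
    (∈-sequences n v (m+n≤o⇒n≤o x ≤n) (m+n≤o⇒n≤o (suc x) ≤b)))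

hasSum? : ∀ k → Decidable (λ xs → Profile xs × sum xs ≡ k)
hasSum? k xs = profile? xs ×-dec (sum xs ≟ k)

-- The profiles of sum k. Being positive, the entries of such a profile are at most
-- k in number, and none exceeds k.
profiles : ℕ → List (List ℕ)
profiles k = filter (hasSum? k) (deduplicate (≡-dec _≟_) (sequences k k))

profiles-unique : ∀ k → Unique (profiles k)
profiles-unique k = filter⁺ (hasSum? k) (DecUnique.deduplicate-! (≡-dec _≟_) (sequences k k))

∈-profiles⁺ : ∀ {k xs} → Profile xs → sum xs ≡ k → xs ∈ profiles k
∈-profiles⁺ v refl = ∈-filter⁺ (hasSum? _)
  (∈-deduplicate⁺ (≡-dec _≟_) (∈-sequences _ v ≤-refl ≤-refl)) (v , refl)

∈-profiles⁻ : ∀ k {xs} → xs ∈ profiles k → Profile xs × sum xs ≡ k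
∈-profiles⁻ k xs∈ =
  proj₂ (∈-filter⁻ (hasSum? k) {xs = deduplicate (≡-dec _≟_) (sequences k k)} xs∈)

-- Fountains and profiles

-- The arrangement in which the coins of position suc i, a diagonal of the
-- fountain, occupy the rows h < at xs i. Positions start at 1, while at counts
-- from 0.
Coins : List ℕ → Pred (ℕ × ℕ) 0ℓ
Coins xs (h , p) = 1 ≤ p × h < at xs (pred p)

coins? : ∀ xs → Decidable (Coins xs)
coins? xs (h , p) = (1 ≤? p) ×-dec (h <? at xs (pred p))

fountain : ∀ {xs} → Profile xs → Fountain
fountain {xs} v = record
  { N        = length xs
  ; Coin     = Coins xs
  ; coin?    = coins? xs
  ; inRange  = inRange
  ; bottom   = λ { {suc i} 1≤p p≤N → 1≤p , at-positive v i p≤N }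
  ; supportˡ = λ (1≤p , h<) → 1≤p , <-trans (n<1+n _) h<
  ; supportʳ = λ { {h} {suc i} (1≤p , h<) → s≤s z≤n , s≤s⁻¹ (≤-trans h< (at-drop v i)) }
  }
  where
  inRange : ∀ {h p} → Coins xs (h , p) → 1 ≤ p × p ≤ length xs ∸ h
  inRange {h} {suc i} (1≤p , h<) = 1≤p ,
    m+n≤o⇒m≤o∸n (suc i) (subst (_≤ length xs) (cong suc (+-comm h i))
      (m≤o∸n⇒m+n≤o (suc h) (<⇒≤ (at-nonzero⇒< xs i (≤-<-trans z≤n h<)))
        (≤-trans h< (at-bound v i))))

coins≡sum : ∀ F {xs} → Profile xs → Fountain.N F ≡ length xs → Coin F ≐ Coins xs →
  coins F ≡ sum xs
coins≡sum F {xs} v refl (⊆ , ⊇) = begin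
  count coin? (cartesianProduct (upTo n) (applyUpTo suc n))
    ≡⟨ count-columns coin? (upTo n) (applyUpTo suc n) ⟩
  sum (map column (applyUpTo suc n))
    ≡⟨ cong sum (map-applyUpTo suc column n) ⟩
  sum (applyUpTo (column ∘ suc) n)
    ≡⟨ cong sum (map-upTo (column ∘ suc) n) ⟨
  sum (map (column ∘ suc) (upTo n))
    ≡⟨ cong sum (map-cong column≡at (upTo n)) ⟩
  sum (map (at xs) (upTo n))
    ≡⟨ cong sum (trans (map-upTo (at xs) n) (applyUpTo-at xs)) ⟩
  sum xs
    ∎
  where
  open ≡-Reasoning
  open Fountain F using (coin?)
  n = length xs
  column : ℕ → ℕ
  column p = count (λ h → coin? (h , p)) (upTo n)
  column≡at : ∀ i → column (suc i) ≡ at xs i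
  column≡at i = count-initial (λ h → coin? (h , suc i)) n (at xs i)
    (≤-trans (at-bound v i) (m∸n≤m n i))
    (λ h → mk⇔ (proj₂ ∘ ⊆) (λ h< → ⊇ (s≤s z≤n , h<)))

-- The profile of a fountain lists the sizes of its diagonals: by supportˡ each of
-- them is an initial segment of rows.
fountain-profile : ∀ F → ∃ λ xs → Profile xs × Fountain.N F ≡ length xs × Coin F ≐ Coins xs
fountain-profile F = xs , profile⁺ xs positive step , sym length-xs , ⊆ , ⊇
  where
  open Fountain F hiding (Coin)
  height : ℕ → ℕ
  height i = count (λ h → coin? (h , suc i)) (upTo N)
  xs = applyUpTo height N
  length-xs : length xs ≡ N
  length-xs = length-applyUpTo height N

  height-spec : ∀ i h → Coin F (h , suc i) ⇔ h < height i
  height-spec i = initial-count (λ h → coin? (h , suc i)) N supportˡ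
    (λ c → ≰⇒> λ N≤h → contradiction (proj₂ (inRange c))
      (subst (λ m → ¬ (suc i ≤ m)) (sym (m≤n⇒m∸n≡0 N≤h)) λ ()))

  ⊆ : ∀ {hp} → Coin F hp → Coins xs hp
  ⊆ {h , zero}  c = contradiction (proj₁ (inRange c)) λ ()
  ⊆ {h , suc i} c = s≤s z≤n , subst (h <_)
    (sym (at-applyUpTo height (≤-trans (proj₂ (inRange c)) (m∸n≤m N h))))
    (Equivalence.to (height-spec i h) c)

  ⊇ : ∀ {hp} → Coins xs hp → Coin F hp
  ⊇ {h , suc i} (_ , h<) = Equivalence.from (height-spec i h)
    (subst (h <_) (at-applyUpTo height
      (subst (i <_) length-xs (at-nonzero⇒< xs i (≤-<-trans z≤n h<)))) h<)

  positive : ∀ i → i < length xs → 1 ≤ at xs i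
  positive i i< = proj₂ (⊆ (bottom (s≤s z≤n) (subst (i <_) length-xs i<)))

  step : ∀ i → at xs i ≤ suc (at xs (suc i))
  step i = bound _ _ (λ h h< → proj₂ (⊆ (supportʳ (⊇ {suc h , suc i} (s≤s z≤n , h<)))))
    where
    bound : ∀ m n → (∀ h → suc h < m → h < n) → m ≤ suc n
    bound zero          n _ = z≤n
    bound (suc zero)    n _ = s≤s z≤n
    bound (suc (suc m)) n f = s≤s (f m ≤-refl)

Coins-injective : ∀ {xs ys} → Profile xs → Profile ys → Coins xs ≐ Coins ys → xs ≡ ys
Coins-injective v w (⊆ , ⊇) = at≡⇒≡ v w λ i → ≤-antisym
  (≮⇒≥ λ lt → <-irrefl refl (proj₂ (⊆ {_ , suc i} (s≤s z≤n , lt))))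
  (≮⇒≥ λ lt → <-irrefl refl (proj₂ (⊇ {_ , suc i} (s≤s z≤n , lt))))

fountains-cardinality : ∀ k → HasCardinality (Fountains k) (length (profiles k))
fountains-cardinality k = correspondence⇒cardinality (Fountains k) (profiles k) (profiles-unique k)
  (λ xs (F , _) → Coin F ≐ Coins xs)
  (λ xs∈ → let v , s = ∈-profiles⁻ k xs∈ in
    (fountain v , trans (coins≡sum (fountain v) v refl (id , id)) s) , id , id)
  (λ (F , c) → let xs , v , n , e = fountain-profile F in
    xs , ∈-profiles⁺ v (trans (sym (coins≡sum F v n e)) c) , e)
  (λ (⊆₁ , ⊇₁) (⊆₂ , ⊇₂) → ⊇₂ ∘ ⊆₁ , ⊇₁ ∘ ⊆₂)
  (λ xs∈ ys∈ (⊆₁ , ⊇₁) (⊆₂ , ⊇₂) (to , from) →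
    Coins-injective (proj₁ (∈-profiles⁻ k xs∈)) (proj₁ (∈-profiles⁻ k ys∈))
      (⊆₂ ∘ to ∘ ⊇₁ , ⊆₁ ∘ from ∘ ⊇₂))

-- The pattern 231

-- An occurrence of 231, given by its letters.
record Contains231 (w : Word) : Set where
  constructor occurrence
  field
    {x y z} : ℕ
    embeds  : x ∷ y ∷ z ∷ [] ⊆ w
    z<x     : z < x
    x<y     : x < y

⊆-map⁻ : ∀ (f : A → B) {xs} ys → xs ⊆ map f ys →
  ∃ λ zs → Pointwise (λ x z → x ≡ f z) xs zs × zs ⊆ ys
⊆-map⁻ f []       []         = [] , [] , []
⊆-map⁻ f (y ∷ ys) (_ ∷ʳ s)   = let zs , eqs , t = ⊆-map⁻ f ys s in zs , eqs , y ∷ʳ t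
⊆-map⁻ f (y ∷ ys) (refl ∷ s) = let zs , eqs , t = ⊆-map⁻ f ys s in y ∷ zs , refl ∷ eqs , refl ∷ t

Contains231-map-suc⁻ : ∀ w → Contains231 (map suc w) → Contains231 w
Contains231-map-suc⁻ w (occurrence s (s≤s z<x) (s≤s x<y))
  with _ , refl ∷ refl ∷ refl ∷ [] , t ← ⊆-map⁻ suc w s = occurrence t z<x x<y

lookup-⊆₂ : ∀ (xs : List A) i j → i Fin.< j → lookup xs i ∷ lookup xs j ∷ [] ⊆ xs
lookup-⊆₂ (x ∷ xs) zero    (suc j) _         = refl ∷ from∈ (∈-lookup j)
lookup-⊆₂ (x ∷ xs) (suc i) (suc j) (s≤s i<j) = x ∷ʳ lookup-⊆₂ xs i j i<j

lookup-⊆₃ : ∀ (xs : List A) i j k → i Fin.< j → j Fin.< k →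
  lookup xs i ∷ lookup xs j ∷ lookup xs k ∷ [] ⊆ xs
lookup-⊆₃ (x ∷ xs) zero    (suc j) (suc k) _         (s≤s j<k) = refl ∷ lookup-⊆₂ xs j k j<k
lookup-⊆₃ (x ∷ xs) (suc i) (suc j) (suc k) (s≤s i<j) (s≤s j<k) = x ∷ʳ lookup-⊆₃ xs i j k i<j j<k

⊆⇒index : ∀ {x : A} {xs} → x ∷ [] ⊆ xs → ∃ λ i → lookup xs i ≡ x
⊆⇒index (refl ∷ _) = zero , refl
⊆⇒index (_ ∷ʳ s)   = let i , eq = ⊆⇒index s in suc i , eq

⊆⇒indices₂ : ∀ {x y : A} {xs} → x ∷ y ∷ [] ⊆ xs →
  ∃₂ λ i j → i Fin.< j × lookup xs i ≡ x × lookup xs j ≡ y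
⊆⇒indices₂ (refl ∷ s) = let j , eq = ⊆⇒index s in zero , suc j , s≤s z≤n , refl , eq
⊆⇒indices₂ (_ ∷ʳ s)   =
  let i , j , i<j , eq₁ , eq₂ = ⊆⇒indices₂ s in suc i , suc j , s≤s i<j , eq₁ , eq₂

⊆⇒indices₃ : ∀ {x y z : A} {xs} → x ∷ y ∷ z ∷ [] ⊆ xs →
  ∃₂ λ i j → ∃ λ k → i Fin.< j × j Fin.< k × lookup xs i ≡ x × lookup xs j ≡ y × lookup xs k ≡ z
⊆⇒indices₃ (refl ∷ s) =
  let j , k , j<k , eq₁ , eq₂ = ⊆⇒indices₂ s in
  zero , suc j , suc k , s≤s z≤n , s≤s j<k , refl , eq₁ , eq₂
⊆⇒indices₃ (_ ∷ʳ s)   =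
  let i , j , k , i<j , j<k , eqs = ⊆⇒indices₃ s in
  suc i , suc j , suc k , s≤s i<j , s≤s j<k , eqs

Contains⇒Contains231 : ∀ {w} → Contains w (2 ∷ 3 ∷ 1 ∷ []) → Contains231 w
Contains⇒Contains231 {w} (ι , mono , iso) = occurrence
  (lookup-⊆₃ w _ _ _ (mono {zero} {suc zero} (s≤s z≤n))
    (mono {suc zero} {suc (suc zero)} (s≤s (s≤s z≤n))))
  (Equivalence.to (iso (suc (suc zero)) zero) (s≤s (s≤s z≤n)))
  (Equivalence.to (iso zero (suc zero)) (s≤s (s≤s (s≤s z≤n))))

Contains231⇒Contains : ∀ {w} → Contains231 w → Contains w (2 ∷ 3 ∷ 1 ∷ [])
Contains231⇒Contains {w} (occurrence s z<x x<y)
  with i , j , k , i<j , j<k , refl , refl , refl ← ⊆⇒indices₃ s = ι , mono , iso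
  where
  ι : Fin 3 → Fin (length w)
  ι zero             = i
  ι (suc zero)       = j
  ι (suc (suc zero)) = k

  mono : ∀ {a b} → a Fin.< b → ι a Fin.< ι b
  mono {zero}           {suc zero}       _ = i<j
  mono {zero}           {suc (suc zero)} _ = <-trans i<j j<k
  mono {suc zero}       {suc (suc zero)} _ = j<k
  mono {suc zero}       {suc zero}       (s≤s ())
  mono {suc (suc zero)} {suc zero}       (s≤s ())
  mono {suc (suc zero)} {suc (suc zero)} (s≤s (s≤s ()))

  both : ∀ {m n m′ n′} → m < n → m′ < n′ → m < n ⇔ m′ < n′
  both p q = mk⇔ (λ _ → q) (λ _ → p)
  neither : ∀ {m n m′ n′} → n ≤ m → n′ ≤ m′ → m < n ⇔ m′ < n′
  neither p q = mk⇔ (λ r → contradiction r (≤⇒≯ p)) (λ r → contradiction r (≤⇒≯ q))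
  1≤2 : 1 ≤ 2
  1≤2 = s≤s z≤n
  2≤3 : 2 ≤ 3
  2≤3 = s≤s 1≤2
  z<y = <-trans z<x x<y

  iso : ∀ a b → lookup (2 ∷ 3 ∷ 1 ∷ []) a < lookup (2 ∷ 3 ∷ 1 ∷ []) b ⇔
                lookup w (ι a) < lookup w (ι b)
  iso zero             zero             = neither ≤-refl ≤-refl
  iso zero             (suc zero)       = both ≤-refl x<y
  iso zero             (suc (suc zero)) = neither 1≤2 (<⇒≤ z<x)
  iso (suc zero)       zero             = neither 2≤3 (<⇒≤ x<y)
  iso (suc zero)       (suc zero)       = neither ≤-refl ≤-refl
  iso (suc zero)       (suc (suc zero)) = neither (s≤s z≤n) (<⇒≤ z<y)
  iso (suc (suc zero)) zero             = both ≤-refl z<x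
  iso (suc (suc zero)) (suc zero)       = both 2≤3 z<y
  iso (suc (suc zero)) (suc (suc zero)) = neither ≤-refl ≤-refl

-- Inserting a new least letter

-- Raise all letters by one and insert the letter 1 at index a, or at the end
-- if the word is shorter than a.
push : ℕ → Word → Word
push zero    w       = 1 ∷ map suc w
push (suc a) []      = 1 ∷ []
push (suc a) (x ∷ w) = suc x ∷ push a w

push-↭ : ∀ a w → push a w ↭ 1 ∷ map suc w
push-↭ zero    w       = ↭-refl
push-↭ (suc a) []      = ↭-refl
push-↭ (suc a) (x ∷ w) = ↭-trans (prep (suc x) (push-↭ a w)) (swap (suc x) 1 ↭-refl)

length-push : ∀ a w → length (push a w) ≡ suc (length w)
length-push a w = trans (↭-length (push-↭ a w)) (cong suc (length-map suc w))

letter-bounds : ∀ {w} → IsPermutation w → All (λ x → 1 ≤ x × x ≤ length w) w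
letter-bounds p = All.tabulate λ x∈ → bounds (∈-applyUpTo⁻ suc (∈-resp-↭ p x∈))
  where
  bounds : ∀ {x n} → ∃ (λ i → i < n × x ≡ suc i) → 1 ≤ x × x ≤ n
  bounds (i , i<n , refl) = s≤s z≤n , i<n

letters-positive : ∀ {w} → IsPermutation w → All (1 ≤_) w
letters-positive p = All.map proj₁ (letter-bounds p)

push-permutation : ∀ a {w} → IsPermutation w → IsPermutation (push a w)
push-permutation a {w} p = subst (λ n → push a w ↭ applyUpTo suc n) (sym (length-push a w))
  (↭-trans (push-↭ a w) (prep 1
    (↭-trans (map⁺ suc p) (↭-reflexive (map-applyUpTo suc suc (length w))))))

-- Every non-empty permutation arises by inserting its letter 1.
push-surjective : ∀ {w} → IsPermutation w → w ≢ [] →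
  ∃₂ λ a v → a ≤ length v × IsPermutation v × w ≡ push a v
push-surjective {[]}    p w≢[] = contradiction refl w≢[]
push-surjective {x ∷ w} p _
  with xs , ys , eq ← ∈-∃++ (∈-resp-↭ (↭-sym p) (here refl))
  with v , eq′ , q ← ↭-map-inv suc (↭-sym
    (↭-trans (drop-mid xs [] (subst (_↭ _) eq p))
      (↭-reflexive (sym (map-applyUpTo suc suc (length w))))))
  = length xs , v
  , subst (length xs ≤_) (trans (cong length eq′) (length-map suc v))
      (subst (length xs ≤_) (sym (length-++ xs)) (m≤m+n (length xs) (length ys)))
  , subst (λ n → v ↭ applyUpTo suc n)
      (trans (sym (length-applyUpTo suc (length w))) (↭-length q)) (↭-sym q)
  , trans eq (split xs v eq′)
  where
  split : ∀ xs {ys} v → xs ++ ys ≡ map suc v → xs ++ 1 ∷ ys ≡ push (length xs) v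
  split []       v       refl = refl
  split (x ∷ xs) (y ∷ v) eq   =
    cong₂ _∷_ (proj₁ (∷-injective eq)) (split xs v (proj₂ (∷-injective eq)))

push-injective : ∀ {a b v w} → a ≤ length v → b ≤ length w → All (1 ≤_) v → All (1 ≤_) w →
  push a v ≡ push b w → a ≡ b × v ≡ w
push-injective {zero}  {zero}  _ _ _ _ eq =
  refl , map-injective suc-injective (proj₂ (∷-injective eq))
push-injective {zero}  {suc b} {w = x ∷ w} _ _ _ (x≥1 ∷ _) eq =
  contradiction (suc-injective (proj₁ (∷-injective eq))) (<⇒≢ x≥1)
push-injective {suc a} {zero}  {v = x ∷ v} _ _ (x≥1 ∷ _) _ eq =
  contradiction (suc-injective (sym (proj₁ (∷-injective eq)))) (<⇒≢ x≥1)
push-injective {suc a} {suc b} {x ∷ v} {y ∷ w} (s≤s a≤) (s≤s b≤) (_ ∷ v≥1) (_ ∷ w≥1) eq =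
  let a≡b , v≡w = push-injective a≤ b≤ v≥1 w≥1 (proj₂ (∷-injective eq)) in
  cong suc a≡b , cong₂ _∷_ (suc-injective (proj₁ (∷-injective eq))) v≡w

-- Inversions

-- The number of inversions, summed over their left, larger letters.
inversionsʳ : Word → ℕ
inversionsʳ []      = 0
inversionsʳ (x ∷ w) = count (_<? x) w + inversionsʳ w

inversions≡inversionsʳ : ∀ w → inversions w ≡ inversionsʳ w
inversions≡inversionsʳ w = trans
  (count-rows (inversion? w) (allFin (length w)) (allFin (length w))) (rows w)
  where
  open ≡-Reasoning

  row : ∀ w → Fin (length w) → ℕ
  row w i = count (λ j → inversion? w (i , j)) (allFin (length w))

  tabulate-suc : ∀ n → tabulate suc ≡ map suc (allFin n)
  tabulate-suc n = sym (map-tabulate id suc)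

  skip-zero : ∀ n {P : Pred (Fin (suc n)) 0ℓ} (P? : Decidable P) → ¬ P zero →
    count P? (allFin (suc n)) ≡ count (P? ∘ suc) (allFin n)
  skip-zero n P? ¬P0 = begin
    count P? (zero ∷ tabulate suc)    ≡⟨ cong length (filter-reject P? ¬P0) ⟩
    count P? (tabulate suc)           ≡⟨ cong (count P?) (tabulate-suc n) ⟩
    count P? (map suc (allFin n))     ≡⟨ count-map P? suc (allFin n) ⟩
    count (P? ∘ suc) (allFin n)       ∎

  rows : ∀ w → sum (map (row w) (allFin (length w))) ≡ inversionsʳ w
  rows []      = refl
  rows (x ∷ w) = cong₂ _+_ first rest
    where
    n = length w
    first : row (x ∷ w) zero ≡ count (_<? x) w
    first = begin
      row (x ∷ w) zero
        ≡⟨ skip-zero n (λ j → inversion? (x ∷ w) (zero , j)) (λ ()) ⟩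
      count (λ j → inversion? (x ∷ w) (zero , suc j)) (allFin n)
        ≡⟨ count-≐ _ ((_<? x) ∘ lookup w) (proj₂ , (s≤s z≤n ,_)) (allFin n) ⟩
      count ((_<? x) ∘ lookup w) (allFin n)
        ≡⟨ count-map (_<? x) (lookup w) (allFin n) ⟨
      count (_<? x) (map (lookup w) (allFin n))
        ≡⟨ cong (count (_<? x)) (trans (map-tabulate id (lookup w)) (tabulate-lookup w)) ⟩
      count (_<? x) w
        ∎
    other : ∀ i → row (x ∷ w) (suc i) ≡ row w i
    other i = trans
      (skip-zero n (λ j → inversion? (x ∷ w) (suc i , j)) (λ ()))
      (count-≐ _ (λ j → inversion? w (i , j))
        ((λ (i<j , gt) → s≤s⁻¹ i<j , gt) , (λ (i<j , gt) → s≤s i<j , gt)) (allFin n))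
    rest : sum (map (row (x ∷ w)) (tabulate suc)) ≡ inversionsʳ w
    rest = begin
      sum (map (row (x ∷ w)) (tabulate suc))
        ≡⟨ cong (sum ∘ map (row (x ∷ w))) (tabulate-suc n) ⟩
      sum (map (row (x ∷ w)) (map suc (allFin n)))
        ≡⟨ cong sum (map-∘ (allFin n)) ⟨
      sum (map (row (x ∷ w) ∘ suc) (allFin n))
        ≡⟨ cong sum (map-cong other (allFin n)) ⟩
      sum (map (row w) (allFin n))
        ≡⟨ rows w ⟩
      inversionsʳ w
        ∎

count-<-map-suc : ∀ x w → count (_<? suc x) (map suc w) ≡ count (_<? x) w
count-<-map-suc x w = trans (count-map (_<? suc x) suc w)
  (count-≐ ((_<? suc x) ∘ suc) (_<? x) (s≤s⁻¹ , s≤s) w)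

count-<-push : ∀ a {x} w → 1 ≤ x → count (_<? suc x) (push a w) ≡ suc (count (_<? x) w)
count-<-push zero    {x} w 1≤x = trans (cong length (filter-accept (_<? suc x) (s≤s 1≤x)))
  (cong suc (count-<-map-suc x w))
count-<-push (suc a) {x} []      1≤x = cong length (filter-accept (_<? suc x) {xs = []} (s≤s 1≤x))
count-<-push (suc a) {x} (y ∷ w) 1≤x = begin
  count (_<? suc x) (suc y ∷ push a w)
    ≡⟨ count-∷ (_<? suc x) (suc y) (push a w) ⟩
  indicator (does (y <? x)) + count (_<? suc x) (push a w)
    ≡⟨ cong (indicator (does (y <? x)) +_) (count-<-push a w 1≤x) ⟩
  indicator (does (y <? x)) + suc (count (_<? x) w)
    ≡⟨ +-suc _ _ ⟩
  suc (indicator (does (y <? x)) + count (_<? x) w)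
    ≡⟨ cong suc (count-∷ (_<? x) y w) ⟨
  suc (count (_<? x) (y ∷ w))
    ∎
  where open ≡-Reasoning

inversionsʳ-map-suc : ∀ w → inversionsʳ (map suc w) ≡ inversionsʳ w
inversionsʳ-map-suc []      = refl
inversionsʳ-map-suc (x ∷ w) = cong₂ _+_ (count-<-map-suc x w) (inversionsʳ-map-suc w)

-- The letter 1 at index a forms an inversion with each of the a letters before it.
inversionsʳ-push : ∀ {a w} → a ≤ length w → All (1 ≤_) w →
  inversionsʳ (push a w) ≡ a + inversionsʳ w
inversionsʳ-push {zero} {w} _ _ = cong₂ _+_
  (count-none (_<? 1) {map suc w} (All.map⁺ (All.universal (λ { _ (s≤s ()) }) w)))
  (inversionsʳ-map-suc w)
inversionsʳ-push {suc a} {x ∷ w} (s≤s a≤) (1≤x ∷ 1≤w) = begin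
  count (_<? suc x) (push a w) + inversionsʳ (push a w)
    ≡⟨ cong₂ _+_ (count-<-push a w 1≤x) (inversionsʳ-push a≤ 1≤w) ⟩
  suc (m + (a + inversionsʳ w))
    ≡⟨ cong suc (+-assoc m a _) ⟨
  suc (m + a + inversionsʳ w)
    ≡⟨ cong (λ n → suc (n + inversionsʳ w)) (+-comm m a) ⟩
  suc (a + m + inversionsʳ w)
    ≡⟨ cong suc (+-assoc a m _) ⟩
  suc (a + (m + inversionsʳ w))
    ∎
  where
  open ≡-Reasoning
  m = count (_<? x) w

-- Pattern avoidance under insertion

map-suc-⊆-push : ∀ a w → map suc w ⊆ push a w
map-suc-⊆-push zero    w       = 1 ∷ʳ ⊆-refl
map-suc-⊆-push (suc a) []      = minimum _
map-suc-⊆-push (suc a) (x ∷ w) = refl ∷ map-suc-⊆-push a w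

Contains231-push : ∀ a {w} → Contains231 w → Contains231 (push a w)
Contains231-push a {w} (occurrence s z<x x<y) =
  occurrence (⊆-trans (Sublist.map⁺ suc s) (map-suc-⊆-push a w)) (s≤s z<x) (s≤s x<y)

take-⊆-push : ∀ a w {xs} → xs ⊆ take a w → map suc xs ++ 1 ∷ [] ⊆ push a w
take-⊆-push zero    w       []         = refl ∷ minimum _
take-⊆-push (suc a) []      []         = ⊆-refl
take-⊆-push (suc a) (x ∷ w) (_ ∷ʳ s)   = suc x ∷ʳ take-⊆-push a w s
take-⊆-push (suc a) (x ∷ w) (refl ∷ s) = refl ∷ take-⊆-push a w s

-- An ascent before the inserted 1 becomes an occurrence of 231.
ascent⇒Contains231 : ∀ {a w x y} → 1 ≤ x → x < y → x ∷ y ∷ [] ⊆ take a w →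
  Contains231 (push a w)
ascent⇒Contains231 {a} {w} 1≤x x<y s = occurrence (take-⊆-push a w s) (s≤s 1≤x) (s≤s x<y)

-- Insertion after smaller letters only preserves the absence of a pair y, z of
-- letters, y before z, with u strictly between z and y: the inserted 1 could only
-- serve as z, and then y would be one of the letters before it.
push-no-straddle : ∀ {u} a w → (∀ {y z} → y ∷ z ∷ [] ⊆ w → z < u → u < y → ⊥) →
  All (u >_) (take a w) → ∀ {y z} → y ∷ z ∷ [] ⊆ push a w → z < suc u → suc u < y → ⊥
push-no-straddle zero    w       none _          (refl ∷ s) _   (s≤s ())
push-no-straddle zero    w       none _          (_ ∷ʳ s)   z<u u<y
  with _ , refl ∷ refl ∷ [] , t ← ⊆-map⁻ suc w s = none t (s≤s⁻¹ z<u) (s≤s⁻¹ u<y)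
push-no-straddle (suc a) []      none _          (_ ∷ʳ ())  _   _
push-no-straddle (suc a) []      none _          (_ ∷ ())   _   _
push-no-straddle (suc a) (v ∷ w) none (v<u ∷ _)  (refl ∷ s) _   u<v = <-asym v<u (s≤s⁻¹ u<v)
push-no-straddle (suc a) (v ∷ w) none (_ ∷ <u)   (_ ∷ʳ s)   z<u u<y =
  push-no-straddle a w (none ∘ (v ∷ʳ_)) <u s z<u u<y

-- Without an ascent before it the inserted 1 lies in no occurrence of 231.
push-avoids : ∀ a w → AllPairs _>_ (take a w) → ¬ Contains231 w → ¬ Contains231 (push a w)
push-avoids zero    w       _ avoids (occurrence (_ ∷ʳ s) z<x x<y) =
  avoids (Contains231-map-suc⁻ w (occurrence s z<x x<y))
push-avoids zero    w       _ avoids (occurrence (refl ∷ s) z<x x<y)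
  with _ , _ ∷ refl ∷ [] , _ ← ⊆-map⁻ suc w s = contradiction (s≤s⁻¹ z<x) λ ()
push-avoids (suc a) []      _ avoids (occurrence (_ ∷ʳ ()) _ _)
push-avoids (suc a) []      _ avoids (occurrence (refl ∷ ()) _ _)
push-avoids (suc a) (x ∷ w) (_ ∷ desc) avoids (occurrence (_ ∷ʳ s) z<x x<y) =
  push-avoids a w desc (λ (occurrence t p q) → avoids (occurrence (x ∷ʳ t) p q))
    (occurrence s z<x x<y)
push-avoids (suc a) (x ∷ w) (x> ∷ _) avoids (occurrence (refl ∷ s) z<x x<y) =
  push-no-straddle a w (λ t p q → avoids (occurrence (refl ∷ t) p q)) x> s z<x x<y

take-push-below : ∀ {u} a w → 1 ≤ u → All (u >_) (take a w) →
  All (suc u >_) (take (suc a) (push a w))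
take-push-below zero    w       1≤u _         = s≤s 1≤u ∷ []
take-push-below (suc a) []      1≤u _         = s≤s 1≤u ∷ []
take-push-below (suc a) (x ∷ w) 1≤u (x< ∷ <u) = s≤s x< ∷ take-push-below a w 1≤u <u

take-push-descending : ∀ a w → All (1 ≤_) w → AllPairs _>_ (take a w) →
  AllPairs _>_ (take (suc a) (push a w))
take-push-descending zero    w       _           _           = [] ∷ []
take-push-descending (suc a) []      _           _           = [] ∷ []
take-push-descending (suc a) (x ∷ w) (1≤x ∷ 1≤w) (x> ∷ desc) =
  take-push-below a w 1≤x x> ∷ take-push-descending a w 1≤w desc

AllPairs-take : ∀ {R : A → A → Set r} {m n} xs → m ≤ n →
  AllPairs R (take n xs) → AllPairs R (take m xs)
AllPairs-take xs z≤n _ = []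
AllPairs-take {R = R} {m} {n} xs m≤n pairs = subst (AllPairs R)
  (trans (take-take m n xs) (cong (λ l → take l xs) (m≤n⇒m⊓n≡m m≤n))) (AllPairs.take⁺ m pairs)

-- The 1 inserted at index b forms an ascent with the letter that follows it.
push-ascent : ∀ {a b w} → b < length w → suc b < a → All (1 ≤_) w →
  ∃ λ x → 1 < x × 1 ∷ x ∷ [] ⊆ take a (push b w)
push-ascent {suc (suc a)} {zero}  {x ∷ w} _         _         (1≤x ∷ _) =
  suc x , s≤s 1≤x , refl ∷ refl ∷ minimum _
push-ascent {suc zero}    {zero}          _         (s≤s ())  _
push-ascent {suc a}       {suc b} {x ∷ w} (s≤s b<)  (s≤s b<a) (_ ∷ 1≤w) =
  let y , 1<y , s = push-ascent b< b<a 1≤w in y , 1<y , suc x ∷ʳ s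

-- Sums and insertion

push-++ : ∀ {a} xs ys → a ≤ length xs → push a (xs ++ ys) ≡ push a xs ++ map suc ys
push-++ {zero}  xs       ys _         = cong (1 ∷_) (map-++ suc xs ys)
push-++ {suc a} (x ∷ xs) ys (s≤s a≤) = cong (suc x ∷_) (push-++ xs ys a≤)

push-⊕ : ∀ {a} ρ τ → a ≤ length ρ → push a (ρ ⊕ τ) ≡ push a ρ ⊕ τ
push-⊕ {a} ρ τ a≤ = trans (push-++ ρ (map (length ρ +_) τ) a≤)
  (cong (push a ρ ++_) (trans (sym (map-∘ τ))
    (cong (λ n → map (n +_) τ) (sym (length-push a ρ)))))

singleton-⊆-take-++ : ∀ {a} (xs : List A) {y ys} → length xs < a → y ∷ [] ⊆ take a (xs ++ y ∷ ys)
singleton-⊆-take-++ {a = suc a} []       _         = refl ∷ minimum _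
singleton-⊆-take-++ {a = suc a} (x ∷ xs) (s≤s <a) = x ∷ʳ singleton-⊆-take-++ xs <a

push≢[] : ∀ a w → push a w ≢ []
push≢[] zero    w       ()
push≢[] (suc a) []      ()
push≢[] (suc a) (x ∷ w) ()

-- If 1 is inserted to the left of, or inside, the first summand of ρ ⊕ τ, then
-- ρ absorbs it. Otherwise it forms 231 with the first letters of both summands.
push-decomposable : ∀ a {w} → ¬ Contains231 (push a w) → Decomposable w → Decomposable (push a w)
push-decomposable a avoids ([] , τ , (_ , ρ≢[]) , _) = contradiction refl ρ≢[]
push-decomposable a avoids (_ ∷ _ , [] , _ , (_ , τ≢[]) , _) = contradiction refl τ≢[]
push-decomposable a avoids (ρ@(x ∷ ρ′) , τ@(y ∷ _) , (pρ , _) , pτ , refl)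
  with a ≤? length ρ
... | yes a≤ = push a ρ , τ , (push-permutation a pρ , push≢[] a ρ) , pτ , push-⊕ ρ τ a≤
... | no  a≰ = contradiction
  (ascent⇒Contains231 (proj₁ x-bounds)
    (≤-<-trans (proj₂ x-bounds) (m<m+n (length ρ) (All.head (letters-positive (proj₁ pτ)))))
    (ascent (≰⇒> a≰)))
  avoids
  where
  x-bounds = All.head (letter-bounds pρ)
  ascent : ∀ {a} → length ρ < a → x ∷ length ρ + y ∷ [] ⊆ take a (ρ ⊕ τ)
  ascent (s≤s ρ′<a) = refl ∷ singleton-⊆-take-++ ρ′ ρ′<a

-- Permutations and profiles

-- For a profile xs, the permutation of length suc (length xs) in which exactly
-- at xs i letters larger than suc i stand to the left of the letter suc i.
permutation : List ℕ → Word
permutation []       = 1 ∷ []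
permutation (x ∷ xs) = push x (permutation xs)

permutation-isPermutation : ∀ xs → IsPermutation (permutation xs)
permutation-isPermutation []       = ↭-refl
permutation-isPermutation (x ∷ xs) = push-permutation x (permutation-isPermutation xs)

permutation-positive : ∀ xs → All (1 ≤_) (permutation xs)
permutation-positive xs = letters-positive (permutation-isPermutation xs)

length-permutation : ∀ xs → length (permutation xs) ≡ suc (length xs)
length-permutation []       = refl
length-permutation (x ∷ xs) =
  trans (length-push x (permutation xs)) (cong suc (length-permutation xs))

permutation≢[] : ∀ xs → permutation xs ≢ []
permutation≢[] []       ()
permutation≢[] (x ∷ xs) = push≢[] x (permutation xs)

index-bound : ∀ {x xs} → Profile (x ∷ xs) → x ≤ length (permutation xs)
index-bound {xs = xs} (cons _ x≤ v) =
  subst (_ ≤_) (sym (length-permutation xs)) (≤-trans x≤ (s≤s (at-bound v 0)))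

permutation-inversions : ∀ {xs} → Profile xs → inversions (permutation xs) ≡ sum xs
permutation-inversions {xs} v = trans (inversions≡inversionsʳ (permutation xs)) (go v)
  where
  go : ∀ {xs} → Profile xs → inversionsʳ (permutation xs) ≡ sum xs
  go [] = refl
  go {x ∷ xs} v@(cons _ _ v′) = trans
    (inversionsʳ-push (index-bound v) (permutation-positive xs)) (cong (x +_) (go v′))

-- The letters up to and including 1 decrease: at xs 0 is the index of 1.
permutation-descending : ∀ {xs} → Profile xs → AllPairs _>_ (take (suc (at xs 0)) (permutation xs))
permutation-descending [] = [] ∷ []
permutation-descending {x ∷ xs} (cons _ x≤ v) =
  take-push-descending x (permutation xs) (permutation-positive xs)
    (AllPairs-take (permutation xs) x≤ (permutation-descending v))

permutation-avoids : ∀ {xs} → Profile xs → ¬ Contains231 (permutation xs)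
permutation-avoids [] (occurrence (refl ∷ ()) _ _)
permutation-avoids [] (occurrence (_ ∷ʳ ()) _ _)
permutation-avoids {x ∷ xs} (cons _ x≤ v) = push-avoids x (permutation xs)
  (AllPairs-take (permutation xs) x≤ (permutation-descending v)) (permutation-avoids v)

-- In a decomposition the first summand contains 1. Removing 1 leaves a
-- decomposition of the smaller word, unless that summand was the word 1 alone, in
-- which case the index of 1 is 0.
permutation-indecomposable : ∀ {xs} → Profile xs → ¬ Decomposable (permutation xs)
permutation-indecomposable [] ([] , _ , (_ , ρ≢[]) , _) = ρ≢[] refl
permutation-indecomposable [] (_ ∷ _ , [] , _ , (_ , τ≢[]) , _) = τ≢[] refl
permutation-indecomposable [] (_ ∷ [] , _ ∷ _ , _ , _ , ())
permutation-indecomposable [] (_ ∷ _ ∷ _ , _ ∷ _ , _ , _ , ())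
permutation-indecomposable {x ∷ xs} v@(cons 1≤x _ v′) (ρ , τ , (pρ , ρ≢[]) , (pτ , τ≢[]) , eq)
  with b , ρ′ , b≤ , pρ′ , refl ← push-surjective pρ ρ≢[]
  with refl , eq′ ← push-injective (index-bound v)
    (≤-trans b≤ (subst (length ρ′ ≤_) (sym (length-++ ρ′)) (m≤m+n _ _)))
    (permutation-positive xs)
    (All.++⁺ (letters-positive pρ′)
      (All.map⁺ (All.map (λ {y} 1≤y → ≤-trans 1≤y (m≤n+m y (length ρ′))) (letters-positive pτ))))
    (trans eq (sym (push-⊕ ρ′ τ b≤)))
  with ρ′
... | []      = contradiction (≤-trans 1≤x b≤) λ ()
... | ρ′@(_ ∷ _) = permutation-indecomposable v′ (ρ′ , τ , (pρ′ , λ ()) , (pτ , τ≢[]) , eq′)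

permutation-injective : ∀ {xs ys} → Profile xs → Profile ys →
  permutation xs ≡ permutation ys → xs ≡ ys
permutation-injective {xs} {ys} v w eq with xs | ys | v | w
... | []     | []     | _ | _ = refl
... | []     | y ∷ ys | _ | _ = contradiction
  (suc-injective (trans (cong length eq) (length-permutation (y ∷ ys)))) λ ()
... | x ∷ xs | []     | _ | _ = contradiction
  (suc-injective (trans (cong length (sym eq)) (length-permutation (x ∷ xs)))) λ ()
... | x ∷ xs | y ∷ ys | v@(cons _ _ v′) | w@(cons _ _ w′) =
  let x≡y , eq′ = push-injective (index-bound v) (index-bound w)
        (permutation-positive xs) (permutation-positive ys) eq in
  cong₂ _∷_ x≡y (permutation-injective v′ w′ eq′)

-- Otherwise the 1 of permutation xs and the letter that follows it both precede
-- the inserted letter.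
avoids⇒index-bound : ∀ {a xs} → Profile xs → a ≤ length (permutation xs) →
  ¬ Contains231 (push a (permutation xs)) → a ≤ suc (at xs 0)
avoids⇒index-bound []                             a≤ _      = a≤
avoids⇒index-bound {a} {x ∷ xs} v@(cons _ _ _) a≤ avoids = ≮⇒≥ λ x+1<a →
  let y , 1<y , s = push-ascent
        (s≤s⁻¹ (≤-trans x+1<a (subst (a ≤_) (length-push x (permutation xs)) a≤)))
        x+1<a (permutation-positive xs)
  in avoids (ascent⇒Contains231 ≤-refl 1<y s)

permutation-surjective : ∀ n {w} → length w ≡ suc n → IsPermutation w → ¬ Decomposable w →
  ¬ Contains231 w → ∃ λ xs → Profile xs × permutation xs ≡ w
permutation-surjective zero {_ ∷ []} _ p _ _
  with push-surjective p (λ ())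
... | _ , [] , z≤n , _ , eq = [] , [] , sym eq
... | a , (y ∷ v) , _ , _ , eq = contradiction
  (suc-injective (trans (cong length eq) (length-push a (y ∷ v)))) λ ()
permutation-surjective (suc n) len p indec avoids
  with a , v , a≤ , pv , refl ← push-surjective p (λ { refl → contradiction len λ () })
  with xs , prof , refl ← permutation-surjective n
    (suc-injective (trans (sym (length-push a v)) len)) pv
    (indec ∘ push-decomposable a avoids) (avoids ∘ Contains231-push a)
  = a ∷ xs , cons (n≢0⇒n>0 a≢0) (avoids⇒index-bound prof a≤ avoids) prof , refl
  where
  -- Insertion at index 0 prepends the summand 1.
  a≢0 : a ≢ 0
  a≢0 refl = indec (1 ∷ [] , permutation xs , (↭-refl , λ ()) , (pv , permutation≢[] xs) , refl)

I-cardinality : ∀ k → HasCardinality (I k ((2 ∷ 3 ∷ 1 ∷ []) ∷ [])) (length (profiles k))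
I-cardinality k = correspondence⇒cardinality (I k _) (profiles k) (profiles-unique k)
  (λ xs (w , _) → permutation xs ≡ w)
  (λ {xs} xs∈ → let v , s = ∈-profiles⁻ k xs∈ in
    (permutation xs , permutation-isPermutation xs ,
      (permutation≢[] xs , permutation-indecomposable v) ,
      trans (permutation-inversions v) s ,
      (permutation-avoids v ∘ Contains⇒Contains231) ∷ []) ,
    refl)
  surj
  (λ eq₁ eq₂ → trans (sym eq₁) eq₂)
  (λ xs∈ ys∈ eq₁ eq₂ eq → permutation-injective
    (proj₁ (∈-profiles⁻ k xs∈)) (proj₁ (∈-profiles⁻ k ys∈)) (trans eq₁ (trans eq (sym eq₂))))
  where
  surj : ((w , _) : ∃ (InI k _)) → ∃ λ xs → xs ∈ profiles k × permutation xs ≡ w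
  surj ([]    , _ , (w≢[] , _) , _) = contradiction refl w≢[]
  surj (x ∷ w , p , (_ , indec) , inv≡k , avoids ∷ []) =
    let xs , v , eq =
          permutation-surjective (length w) refl p indec (avoids ∘ Contains231⇒Contains) in
    xs ,
    ∈-profiles⁺ v (trans (sym (permutation-inversions v)) (trans (cong inversions eq) inv≡k)) ,
    eq

theorem4 : ∀ (k : ℕ) → ∃[ m ] (HasCardinality (I k ((2 ∷ 3 ∷ 1 ∷ []) ∷ [])) m × HasCardinality (Fountains k) m)
theorem4 k = length (profiles k) , I-cardinality k , fountains-cardinality k
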